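{- For every cwf $\mathcal C$, the assignment $\Gamma\mapsto\mathrm{Pr}^\wedge_{\mathcal C}(\Gamma)$ described below is a functor from $\mathcal C^{\mathrm{op}}$ to the category of lower semilattices (preorders with a top element and binary meets, with maps preserving order, top and meets); that is, $(\mathcal C,\mathrm{Pr}^\wedge_{\mathcal C})$ is a cwf with Horn doctrine. In particular, $\le_\Gamma$ is a preorder on $\mathrm{F}(\Gamma)$, $\langle\rangle$ is a top element, concatenation is a binary meet, and each $f:\Delta\to\Gamma$ induces a map preserving $\le$, $\top$ and $\wedge$.
   Context: A category with families (cwf) consists of: a category $\mathcal C$ with a terminal object $\top$; for each object $\Gamma$ a class $\mathrm{Ty}(\Gamma)$, and for $f:\Delta\to\Gamma$ a function $A\mapsto A\{f\}:\mathrm{Ty}(\Gamma)\to\mathrm{Ty}(\Delta)$ with $A\{1\}=A$, $A\{f\circ g\}=A\{f\}\{g\}$; for $A\in\mathrm{Ty}(\Gamma)$ an object $\Gamma.A$ and a morphism $\mathrm{p}(A)=\mathrm{p}_\Gamma(A):\Gamma.A\to\Gamma$; for $A\in\mathrm{Ty}(\Gamma)$ a class $\mathrm{Tm}(\Gamma,A)$ and for $f:\Delta\to\Gamma$ a function $a\mapsto a\{f\}:\mathrm{Tm}(\Gamma,A)\to\mathrm{Tm}(\Delta,A\{f\})$ with $a\{1\}=a$, $a\{f\circ g\}=a\{f\}\{g\}$; for each $A\in\mathrm{Ty}(\Gamma)$ an element $\mathrm{v}_A\in\mathrm{Tm}(\Gamma.A,A\{\mathrm{p}(A)\})$; for $f:\Delta\to\Gamma$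 and $a\in\mathrm{Tm}(\Delta,A\{f\})$ a morphism $\langle f,a\rangle_A:\Delta\to\Gamma.A$ such that $\mathrm{p}(A)\circ\langle f,a\rangle_A=f$, $\mathrm{v}_A\{\langle f,a\rangle_A\}=a$, $\langle\mathrm{p}(A)\circ h,\mathrm{v}_A\{h\}\rangle_A=h$ for every $h:\Delta\to\Gamma.A$, and $\langle f,a\rangle_A\circ g=\langle f\circ g,a\{g\}\rangle_A$. Notation: $\mathrm{p}^{(0)}=\mathrm{id}$ and $\mathrm{p}^{(k)}$ is the composite of the $k$ last canonical projections, so that for $A_1,\ldots,A_n\in\mathrm{Ty}(\Gamma)$ the object $\Gamma.A_1.A_2\{\mathrm p\}.\cdots.A_n\{\mathrm p^{(n-1)}\}$ is formed by successively extending $\Gamma$ by each $A_k$ pulled back along the composite $\mathrm{p}^{(k-1)}$ of the projections down to $\Gamma$, and $\mathrm{p}^{(n)}$ is its projection to $\Gamma$. $\mathrm{F}(\Gamma)$ is the set of finite sequences $\langle A_1,\ldots,A_n\rangle$ of elements of $\mathrm{Ty}(\Gamma)$, with $\langle A_1,\ldots,A_n\rangle\le_\Gamma\langle B_1,\ldots,B_m\rangle$ iff for every $k=1,\ldots,m$ the class $\mathrm{Tm}(\Gamma.A_1.A_2\{\mathrm p\}.\cdots.A_n\{\mathrm p^{(n-1)}\},B_k\{\mathrm p^{(n)}\})$ is inhabited. $\mathrm{Pr}^\wedge_{\mathcal C}(\Gamma)=(\mathrm F(\Gamma),\le_\Gamma)$ with $\top_\Gamma=\langle\rangle$ and $\langle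 A_1,\ldots,A_n\rangle\wedge_\Gamma\langle B_1,\ldots,B_m\rangle=\langle A_1,\ldots,A_n,B_1,\ldots,B_m\rangle$, and for $f:\Delta\to\Gamma$, $\langle A_1,\ldots,A_n\rangle\{f\}=\langle A_1\{f\},\ldots,A_n\{f\}\rangle$. -}

module Defs where

open import Algebra.Core using (Op₂)
import Algebra.Morphism.Definitions as Algebra
open import Data.List.Base using (List; []; _++_; map; foldl)
open import Data.List.Relation.Unary.All using (All)
open import Data.Product.Base using (Σ; _,_; proj₁; proj₂)
open import Function.Base using (id; _∘′_)
open import Level using (Level; _⊔_; suc)
open import Relation.Binary.Core using (Rel)
open import Relation.Binary.Definitions using (Maximum)
open import Relation.Binary.Lattice.Definitions using (Infimum)
import Relation.Binary.Morphism.Definitions as Order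
open import Relation.Binary.PropositionalEquality
  using (_≡_; refl; sym; trans; cong; subst)
open import Relation.Binary.Structures using (IsEquivalence; IsPreorder)

private
  variable
    o ℓ e o′ ℓ′ e′ t m c r : Level

-- Hom-sets carry an equality _≈_ so that semilattice homomorphisms can be
-- compared pointwise; there is no function extensionality here. For a CwF
-- this equality is forced to be the propositional one (≈⇒≡).

record Category o ℓ e : Set (suc (o ⊔ ℓ ⊔ e)) where
  infix  4 _≈_
  infixr 9 _∘_
  field
    Ob            : Set o
    Hom           : Ob → Ob → Set ℓ
    _≈_           : ∀ {A B} → Rel (Hom A B) e
    1ₕ            : ∀ {A} → Hom A A
    _∘_           : ∀ {A B C} → Hom B C → Hom A B → Hom A C
    isEquivalence : ∀ {A B} → IsEquivalence (_≈_ {A} {B})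
    ∘-resp-≈      : ∀ {A B C} {f f′ : Hom B C} {g g′ : Hom A B} →
                    f ≈ f′ → g ≈ g′ → f ∘ g ≈ f′ ∘ g′
    identityˡ     : ∀ {A B} (f : Hom A B) → 1ₕ ∘ f ≈ f
    identityʳ     : ∀ {A B} (f : Hom A B) → f ∘ 1ₕ ≈ f
    assoc         : ∀ {A B C D} (f : Hom C D) (g : Hom B C) (h : Hom A B) →
                    (f ∘ g) ∘ h ≈ f ∘ (g ∘ h)

op : Category o ℓ e → Category o ℓ e
op 𝒞 = record
  { Ob            = Ob
  ; Hom           = λ A B → Hom B A
  ; _≈_           = _≈_
  ; 1ₕ            = 1ₕ
  ; _∘_           = λ f g → g ∘ f
  ; isEquivalence = isEquivalence
  ; ∘-resp-≈      = λ p q → ∘-resp-≈ q p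
  ; identityˡ     = identityʳ
  ; identityʳ     = identityˡ
  ; assoc         = λ f g h → IsEquivalence.sym isEquivalence (assoc h g f)
  }
  where open Category 𝒞

record IsFunctor (𝒞 : Category o ℓ e) (𝒟 : Category o′ ℓ′ e′)
                 (F₀ : Category.Ob 𝒞 → Category.Ob 𝒟)
                 (F₁ : ∀ {A B} → Category.Hom 𝒞 A B →
                       Category.Hom 𝒟 (F₀ A) (F₀ B))
                 : Set (o ⊔ ℓ ⊔ e ⊔ e′) where
  private
    module C = Category 𝒞
    module D = Category 𝒟
  field
    resp-≈       : ∀ {A B} {f g : C.Hom A B} → f C.≈ g → F₁ f D.≈ F₁ g
    identity     : ∀ {A} → F₁ (C.1ₕ {A}) D.≈ D.1ₕ
    homomorphism : ∀ {A B C} (g : C.Hom B C) (f : C.Hom A B) →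
                   F₁ (g C.∘ f) D.≈ F₁ g D.∘ F₁ f

-- The order is a preorder over propositional equality: antisymmetry is not
-- assumed, and ⊤ and _∧_ are chosen operations.

record RawLowerSemilattice c r : Set (suc (c ⊔ r)) where
  infix  4 _≤_
  infixr 7 _∧_
  field
    Carrier : Set c
    _≤_     : Rel Carrier r
    ⊤       : Carrier
    _∧_     : Op₂ Carrier

record IsLowerSemilattice (L : RawLowerSemilattice c r) : Set (c ⊔ r) where
  open RawLowerSemilattice L
  field
    isPreorder : IsPreorder _≡_ _≤_
    maximum    : Maximum _≤_ ⊤
    infimum    : Infimum _≤_ _∧_

record LowerSemilattice c r : Set (suc (c ⊔ r)) where
  field
    raw                : RawLowerSemilattice c r
    isLowerSemilattice : IsLowerSemilattice raw
  open RawLowerSemilattice raw public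
  open IsLowerSemilattice isLowerSemilattice public

-- The chosen operations are preserved up to equality of the carrier, hence
-- in particular up to the equivalence x ≤ y & y ≤ x.

record IsLowerSemilatticeHom (L M : RawLowerSemilattice c r)
    (⟦_⟧ : RawLowerSemilattice.Carrier L → RawLowerSemilattice.Carrier M)
    : Set (c ⊔ r) where
  private
    module L = RawLowerSemilattice L
    module M = RawLowerSemilattice M
  field
    ≤-homo : Order.Homomorphic₂ L.Carrier M.Carrier L._≤_ M._≤_ ⟦_⟧
    ⊤-homo : Algebra.Homomorphic₀ L.Carrier M.Carrier _≡_ ⟦_⟧ L.⊤ M.⊤
    ∧-homo : Algebra.Homomorphic₂ L.Carrier M.Carrier _≡_ ⟦_⟧ L._∧_ M._∧_

record LowerSemilatticeHom (L M : LowerSemilattice c r) : Set (c ⊔ r) where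
  private
    module L = LowerSemilattice L
    module M = LowerSemilattice M
  field
    ⟦_⟧   : L.Carrier → M.Carrier
    isHom : IsLowerSemilatticeHom L.raw M.raw ⟦_⟧
  open IsLowerSemilatticeHom isHom public

LSL : ∀ c r → Category (suc (c ⊔ r)) (c ⊔ r) c
LSL c r = record
  { Ob            = LowerSemilattice c r
  ; Hom           = LowerSemilatticeHom
  ; _≈_           = λ f g → ∀ x → ⟦ f ⟧ x ≡ ⟦ g ⟧ x
  ; 1ₕ            = record
    { ⟦_⟧   = id
    ; isHom = record
      { ≤-homo = id ; ⊤-homo = refl ; ∧-homo = λ _ _ → refl } }
  ; _∘_           = λ f g → record
    { ⟦_⟧   = ⟦ f ⟧ ∘′ ⟦ g ⟧
    ; isHom = record
      { ≤-homo = λ x≤y → ≤-homo f (≤-homo g x≤y)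
      ; ⊤-homo = trans (cong ⟦ f ⟧ (⊤-homo g)) (⊤-homo f)
      ; ∧-homo = λ x y →
          trans (cong ⟦ f ⟧ (∧-homo g x y)) (∧-homo f (⟦ g ⟧ x) (⟦ g ⟧ y)) } }
  ; isEquivalence = record
    { refl  = λ _ → refl
    ; sym   = λ p x → sym (p x)
    ; trans = λ p q x → trans (p x) (q x) }
  ; ∘-resp-≈      = λ {_} {_} {_} {f} {f′} {g} {g′} p q x →
      trans (cong ⟦ f ⟧ (q x)) (p (⟦ g′ ⟧ x))
  ; identityˡ     = λ _ _ → refl
  ; identityʳ     = λ _ _ → refl
  ; assoc         = λ _ _ _ _ → refl
  }
  where open LowerSemilatticeHom

record CwF o ℓ e t m : Set (suc (o ⊔ ℓ ⊔ e ⊔ t ⊔ m)) where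
  infixl 5 _▷_
  infixl 8 _[_] _[_]ₜ
  field
    category : Category o ℓ e
  open Category category public
  field
    ≈⇒≡      : ∀ {Δ Γ} {f g : Hom Δ Γ} → f ≈ g → f ≡ g

    ⊤        : Ob
    !        : ∀ {Γ} → Hom Γ ⊤
    !-unique : ∀ {Γ} (f : Hom Γ ⊤) → f ≡ !

    Ty       : Ob → Set t
    _[_]     : ∀ {Δ Γ} → Ty Γ → Hom Δ Γ → Ty Δ
    []-id    : ∀ {Γ} (A : Ty Γ) → A [ 1ₕ ] ≡ A
    []-∘     : ∀ {Θ Δ Γ} (A : Ty Γ) (f : Hom Δ Γ) (g : Hom Θ Δ) →
               A [ f ∘ g ] ≡ A [ f ] [ g ]

    _▷_      : (Γ : Ob) → Ty Γ → Ob
    p        : ∀ {Γ} (A : Ty Γ) → Hom (Γ ▷ A) Γ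

    Tm       : (Γ : Ob) → Ty Γ → Set m
    _[_]ₜ    : ∀ {Δ Γ} {A : Ty Γ} → Tm Γ A → (f : Hom Δ Γ) → Tm Δ (A [ f ])

  coe : ∀ {Γ} {A B : Ty Γ} → A ≡ B → Tm Γ A → Tm Γ B
  coe = subst (Tm _)

  field
    []ₜ-id   : ∀ {Γ} {A : Ty Γ} (a : Tm Γ A) → coe ([]-id A) (a [ 1ₕ ]ₜ) ≡ a
    []ₜ-∘    : ∀ {Θ Δ Γ} {A : Ty Γ} (a : Tm Γ A)
               (f : Hom Δ Γ) (g : Hom Θ Δ) →
               coe ([]-∘ A f g) (a [ f ∘ g ]ₜ) ≡ a [ f ]ₜ [ g ]ₜ

    v        : ∀ {Γ} (A : Ty Γ) → Tm (Γ ▷ A) (A [ p A ])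
    ⟨_,_⟩    : ∀ {Δ Γ} {A : Ty Γ} (f : Hom Δ Γ) → Tm Δ (A [ f ]) →
               Hom Δ (Γ ▷ A)
    p-β      : ∀ {Δ Γ} {A : Ty Γ} (f : Hom Δ Γ) (a : Tm Δ (A [ f ])) →
               p A ∘ ⟨ f , a ⟩ ≡ f
    v-β      : ∀ {Δ Γ} {A : Ty Γ} (f : Hom Δ Γ) (a : Tm Δ (A [ f ])) →
               coe (trans (sym ([]-∘ A (p A) ⟨ f , a ⟩)) (cong (A [_]) (p-β f a)))
                   (v A [ ⟨ f , a ⟩ ]ₜ)
               ≡ a
    ⟨⟩-η     : ∀ {Δ Γ} {A : Ty Γ} (h : Hom Δ (Γ ▷ A)) →
               ⟨ p A ∘ h , coe (sym ([]-∘ A (p A) h)) (v A [ h ]ₜ) ⟩ ≡ h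
    ⟨⟩-∘     : ∀ {Θ Δ Γ} {A : Ty Γ} (f : Hom Δ Γ) (a : Tm Δ (A [ f ]))
               (g : Hom Θ Δ) →
               ⟨ f , a ⟩ ∘ g ≡ ⟨ f ∘ g , coe (sym ([]-∘ A f g)) (a [ g ]ₜ) ⟩

module _ (𝒞 : CwF o ℓ e t m) where
  open CwF 𝒞

  record IsHornDoctrine
      (P     : Ob → RawLowerSemilattice c r)
      (reind : ∀ {Δ Γ} → Hom Δ Γ →
               RawLowerSemilattice.Carrier (P Γ) →
               RawLowerSemilattice.Carrier (P Δ))
      : Set (o ⊔ ℓ ⊔ e ⊔ c ⊔ r) where
    field
      isLowerSemilattice : ∀ Γ → IsLowerSemilattice (P Γ)
      isHom              : ∀ {Δ Γ} (f : Hom Δ Γ) →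
                           IsLowerSemilatticeHom (P Γ) (P Δ) (reind f)
      isFunctor          : IsFunctor (op category) (LSL c r)
        (λ Γ → record { raw = P Γ ; isLowerSemilattice = isLowerSemilattice Γ })
        (λ f → record { ⟦_⟧ = reind f ; isHom = isHom f })

  -- Γ.A₁.A₂{p}.⋯.Aₙ{p⁽ⁿ⁻¹⁾} together with p⁽ⁿ⁾. Starting from p⁽⁰⁾ = 1,
  -- the k-th step extends by Aₖ{p⁽ᵏ⁻¹⁾} and sets p⁽ᵏ⁾ = p⁽ᵏ⁻¹⁾ ∘ p; the
  -- first type is thus A₁{1}, which equals A₁.

  extend : ∀ {Γ} → List (Ty Γ) → Σ Ob (λ Δ → Hom Δ Γ)
  extend {Γ} =
    foldl (λ (Δ , q) A → (Δ ▷ A [ q ]) , q ∘ p (A [ q ])) (Γ , 1ₕ)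

  infixl 5 _▷*_

  _▷*_ : (Γ : Ob) → List (Ty Γ) → Ob
  Γ ▷* As = proj₁ (extend As)

  p* : ∀ {Γ} (As : List (Ty Γ)) → Hom (Γ ▷* As) Γ
  p* As = proj₂ (extend As)

  Pr∧ : Ob → RawLowerSemilattice t (t ⊔ m)
  Pr∧ Γ = record
    { Carrier = List (Ty Γ)
    ; _≤_     = λ As Bs → All (λ B → Tm (Γ ▷* As) (B [ p* As ])) Bs
    ; ⊤       = []
    ; _∧_     = _++_
    }

  Pr∧-reind : ∀ {Δ Γ} → Hom Δ Γ → List (Ty Γ) → List (Ty Δ)
  Pr∧-reind f = map (_[ f ])

{-# OPTIONS --safe #-}

-- Γ ▷* As represents tuples of terms: a morphism h : Θ → Γ over which every
-- A{h} with A in As has a term factors through p* As, and conversely the variables give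
-- such terms over p* As itself. Hence As ≤ Bs iff p* As factors through p* Bs,
-- and all order properties reduce to composing factorisations.

module Submission where

open import Defs
open import Data.List.Base using (List; []; _∷_; _++_; foldl)
open import Data.List.Properties using (map-++; map-cong; map-id; map-∘)
open import Data.List.Relation.Unary.All as All using (All; []; _∷_)
open import Data.List.Relation.Unary.All.Properties
  using (++⁺; ++⁻ˡ; ++⁻ʳ; map⁺; map⁻)
open import Data.Product.Base using (Σ; ∃-syntax; _,_; proj₂)
open import Function.Base using (_∘′_)
open import Level using (Level; _⊔_)
open import Relation.Binary.PropositionalEquality
  using (_≡_; refl; sym; trans; cong; isEquivalence; module ≡-Reasoning)

private
  module Terms {o ℓ e t m : Level} (𝒞 : CwF o ℓ e t m) where
    open CwF 𝒞 hiding (isEquivalence)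
    open ≡-Reasoning

    -- `Terms (p* 𝒞 As) Bs` unfolds to `As ≤ Bs`. Letting `f` vary also covers morphisms that are
    -- not iterated projections.
    Terms : ∀ {Θ Γ} → Hom Θ Γ → List (Ty Γ) → Set (t ⊔ m)
    Terms {Θ} f = All (λ A → Tm Θ (A [ f ]))

    ∘-assoc : ∀ {Γ₁ Γ₂ Γ₃ Γ₄}
              (f : Hom Γ₃ Γ₄) (g : Hom Γ₂ Γ₃) (h : Hom Γ₁ Γ₂) →
              (f ∘ g) ∘ h ≡ f ∘ (g ∘ h)
    ∘-assoc f g h = ≈⇒≡ (assoc f g h)

    Terms-factor : ∀ {Ξ Θ Γ} {f : Hom Θ Γ} {h : Hom Ξ Γ} {As : List (Ty Γ)} →
                   (k : Hom Ξ Θ) → f ∘ k ≡ h → Terms f As → Terms h As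
    Terms-factor {f = f} k refl =
      All.map λ {A} a → coe (sym ([]-∘ A f k)) (a [ k ]ₜ)

    module _ {Γ : Ob} where

      -- `foldl` changes its accumulator at each step, so inductions on the list need an arbitrary
      -- start `(Δ , q)`; `extend` is the case `(Γ , 1ₕ)`.
      extendFrom : Σ Ob (λ Δ → Hom Δ Γ) → List (Ty Γ) → Σ Ob (λ Δ → Hom Δ Γ)
      extendFrom = foldl λ (Δ , q) A → (Δ ▷ A [ q ]) , q ∘ p (A [ q ])

      -- The witness composes the projections of all later extensions; along it, variables are
      -- weakened to the final object.
      extendFrom-p : ∀ {Δ} (q : Hom Δ Γ) As → let (E , r) = extendFrom (Δ , q) As in
                     ∃[ w ] q ∘ w ≡ r
      extendFrom-p q []       = 1ₕ , ≈⇒≡ (identityʳ q)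
      extendFrom-p q (A ∷ As) =
        let w , eq = extendFrom-p (q ∘ p (A [ q ])) As
        in  p (A [ q ]) ∘ w , trans (sym (∘-assoc q (p (A [ q ])) w)) eq

      extendFrom-v : ∀ {Δ} (q : Hom Δ Γ) As →
                     Terms (proj₂ (extendFrom (Δ , q) As)) As
      extendFrom-v q []       = []
      extendFrom-v q (A ∷ As) =
        let q′     = q ∘ p (A [ q ])
            w , eq = extendFrom-p q′ As
            -- The newest variable lives over `q′`, before the types in `As` are added; `w` carries
            -- it the rest of the way.
            a      = coe (sym ([]-∘ A q (p (A [ q ])))) (v (A [ q ]))
        in  All.head (Terms-factor w eq (a ∷ [])) ∷ extendFrom-v q′ As

      -- Each term extends the morphism built so far by pairing. By `p-β` the result still lies over
      -- `f`, so the remaining terms keep their types.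
      extendFrom-factor : ∀ {Δ Θ} (q : Hom Δ Γ) {f : Hom Θ Γ} {As} (h : Hom Θ Δ) →
                          q ∘ h ≡ f → Terms f As →
                          let (E , r) = extendFrom (Δ , q) As in ∃[ k ] r ∘ k ≡ f
      extendFrom-factor q {As = []}    h eq   []       = h , eq
      extendFrom-factor q {As = A ∷ _} h refl (a ∷ as) =
        extendFrom-factor (q ∘ p (A [ q ])) ⟨ h , a′ ⟩ over as
        where
        a′ = coe ([]-∘ A q h) a

        over : (q ∘ p (A [ q ])) ∘ ⟨ h , a′ ⟩ ≡ q ∘ h
        over = begin
          (q ∘ p (A [ q ])) ∘ ⟨ h , a′ ⟩  ≡⟨ ∘-assoc q (p (A [ q ])) ⟨ h , a′ ⟩ ⟩
          q ∘ (p (A [ q ]) ∘ ⟨ h , a′ ⟩)  ≡⟨ cong (q ∘_) (p-β h a′) ⟩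
          q ∘ h                           ∎

    vars : ∀ {Γ} (As : List (Ty Γ)) → Terms (p* 𝒞 As) As
    vars = extendFrom-v 1ₕ

    -- The terms `as` make `f` factor through `p* 𝒞 As`, and `bs` is substituted along the factor.
    -- Transitivity is the case where `f` is itself an iterated projection.
    Terms-trans : ∀ {Θ Γ} {f : Hom Θ Γ} {As Bs} →
                  Terms f As → Terms (p* 𝒞 As) Bs → Terms f Bs
    Terms-trans {f = f} as bs =
      let k , eq = extendFrom-factor 1ₕ f (≈⇒≡ (identityˡ f)) as
      in  Terms-factor k eq bs

    Terms-map⁺ : ∀ {Θ Δ Γ} (f : Hom Δ Γ) {g : Hom Θ Δ} {As} →
                 Terms (f ∘ g) As → Terms g (Pr∧-reind 𝒞 f As)
    Terms-map⁺ f {g} = map⁺ ∘′ All.map λ {A} → coe ([]-∘ A f g)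

    Terms-map⁻ : ∀ {Θ Δ Γ} (f : Hom Δ Γ) {g : Hom Θ Δ} {As} →
                 Terms g (Pr∧-reind 𝒞 f As) → Terms (f ∘ g) As
    Terms-map⁻ f {g} = All.map (λ {A} → coe (sym ([]-∘ A f g))) ∘′ map⁻

    Pr∧-isLowerSemilattice : ∀ Γ → IsLowerSemilattice (Pr∧ 𝒞 Γ)
    Pr∧-isLowerSemilattice Γ = record
      { isPreorder = record
        { isEquivalence = isEquivalence
        ; reflexive     = λ { {As} refl → vars As }
        ; trans         = Terms-trans
        }
      ; maximum    = λ _ → []
      -- The variables of the concatenation split into those of `As` and those of `Bs`, which gives
      -- both lower bounds.
      ; infimum    = λ As Bs →
          ++⁻ˡ As (vars (As ++ Bs)) , ++⁻ʳ As (vars (As ++ Bs)) , λ _ → ++⁺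
      }

    Pr∧-reind-isHom : ∀ {Δ Γ} (f : Hom Δ Γ) →
                      IsLowerSemilatticeHom (Pr∧ 𝒞 Γ) (Pr∧ 𝒞 Δ) (Pr∧-reind 𝒞 f)
    Pr∧-reind-isHom f = record
      { ≤-homo = λ {As} As≤Bs →
          -- Variables of the reindexed list, read over `f` composed with its projection, are terms
          -- for `As`; substituting them into `As≤Bs` gives terms for `Bs` over the same composite.
          Terms-map⁺ f (Terms-trans (Terms-map⁻ f (vars (Pr∧-reind 𝒞 f As))) As≤Bs)
      ; ⊤-homo = refl
      ; ∧-homo = map-++ (_[ f ])
      }

    Pr∧-isHornDoctrine : IsHornDoctrine 𝒞 (Pr∧ 𝒞) (Pr∧-reind 𝒞)
    Pr∧-isHornDoctrine = record
      { isLowerSemilattice = Pr∧-isLowerSemilattice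
      ; isHom              = Pr∧-reind-isHom
      ; isFunctor          = record
        { resp-≈       = λ f≈g As → cong (λ f → Pr∧-reind 𝒞 f As) (≈⇒≡ f≈g)
        ; identity     = λ As → trans (map-cong []-id As) (map-id As)
        ; homomorphism = λ g f As →
            trans (map-cong (λ A → []-∘ A f g) As) (map-∘ As)
        }
      }

mainTheorem16 : ∀ {o ℓ e t m : Level} (𝒞 : CwF o ℓ e t m) →
    IsHornDoctrine 𝒞 (Pr∧ 𝒞) (Pr∧-reind 𝒞)
mainTheorem16 = Terms.Pr∧-isHornDoctrine
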